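{- For every prime $p\ge 3$ we have $n(\mathbb{Z}_p) \le \frac{3p-1}{2}$.
   Context: For an integer $n\ge 1$, $\overleftrightarrow{K}_n$ denotes the complete digraph on $n$ vertices whose arc set consists of all ordered pairs $(x,y)$ of distinct vertices. For a set $A$, an $A$-arc-labelling of $\overleftrightarrow{K}_n$ is a function $w$ from the arc set of $\overleftrightarrow{K}_n$ to $A$. If $(A,+)$ is an Abelian group, $w$ is called zero-sum-free if there is no directed cycle (including directed cycles of length two) for which the sum of the arc-labels is $0$. For a non-trivial finite Abelian group $A$, $n(A)\ge 2$ is the smallest integer such that $\overleftrightarrow{K}_{n(A)}$ has no zero-sum-free $A$-arc-labelling. $\mathbb{Z}_p$ denotes the cyclic group of order $p$. -}

module Defs where

open import Algebra.Bundles using (AbelianGroup)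
open import Algebra.Definitions using (Associative; Commutative; LeftIdentity; LeftInverse)
import Algebra.Properties.Monoid.Sum as MonoidSum
open import Data.Fin.Base using (Fin; toℕ)
open import Data.Fin.Properties using (toℕ-injective; toℕ-fromℕ<; toℕ<n; toℕ≤n)
open import Data.Nat.Base using (ℕ; suc; _+_; _∸_; _%_; _≤_; NonZero)
open import Data.Nat.DivMod
open import Data.Nat.Properties using (+-assoc; +-comm; m∸n+n≡m; 1+n≢n; ≤∧≢⇒<; _≟_)
open import Data.Product.Base using (Σ-syntax; _×_; _,_)
open import Function.Definitions using (Injective)
open import Level using (Level; 0ℓ; _⊔_)
open import Relation.Binary.PropositionalEquality
open import Relation.Nullary using (¬_; yes; no)

open ≡-Reasoning

private
  variable
    a ℓ : Level

-- The arcs of the complete digraph with vertex set Fin n.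

Arc : ℕ → Set
Arc n = Σ[ (x , y) ∈ Fin n × Fin n ] x ≢ y

ArcLabelling : Set a → ℕ → Set a
ArcLabelling A n = Arc n → A

-- Cyclic successor, with n - 1 followed by 0.

next : ∀ {n} .{{_ : NonZero n}} → Fin n → Fin n
next {n} i = suc (toℕ i) mod n

toℕ-mod : ∀ m n .{{_ : NonZero n}} → toℕ (m mod n) ≡ m % n
toℕ-mod m n = toℕ-fromℕ< (m%n<n m n)

next-≢ : ∀ {k} (i : Fin (2 + k)) → i ≢ next i
next-≢ {k} i i≡next with suc (toℕ i) ≟ 2 + k
... | no  1+i≢n = 1+n≢n (begin
  suc (toℕ i)            ≡⟨ m<n⇒m%n≡m (≤∧≢⇒< (toℕ<n i) 1+i≢n) ⟨
  suc (toℕ i) % (2 + k)  ≡⟨ toℕ-mod (suc (toℕ i)) (2 + k) ⟨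
  toℕ (next i)           ≡⟨ cong toℕ i≡next ⟨
  toℕ i                  ∎)
... | yes 1+i≡n with () ← (begin
  2 + k                       ≡⟨ 1+i≡n ⟨
  suc (toℕ i)                 ≡⟨ cong (λ j → suc (toℕ j)) i≡next ⟩
  suc (toℕ (next i))          ≡⟨ cong suc (toℕ-mod (suc (toℕ i)) (2 + k)) ⟩
  suc (suc (toℕ i) % (2 + k)) ≡⟨ cong (λ m → suc (m % (2 + k))) 1+i≡n ⟩
  suc ((2 + k) % (2 + k))     ≡⟨ cong suc (n%n≡0 (2 + k)) ⟩
  1                           ∎)

-- A directed cycle v₀ → v₁ → … → v₍ₗ₋₁₎ → v₀ through l = 2 + extra distinct
-- vertices; all of its arcs are present because the digraph is complete.

record DirectedCycle (n : ℕ) : Set where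
  field
    extra     : ℕ

  length : ℕ
  length = 2 + extra

  field
    vertex    : Fin length → Fin n
    injective : Injective _≡_ _≡_ vertex

  arc : Fin length → Arc n
  arc i = (vertex i , vertex (next i)) , λ eq → next-≢ i (injective eq)

module _ (A : AbelianGroup a ℓ) where
  open AbelianGroup A using (Carrier; _≈_; ε; monoid)
  open MonoidSum monoid using (sum)

  cycleSum : ∀ {n} → ArcLabelling Carrier n → DirectedCycle n → Carrier
  cycleSum w C = sum (λ i → w (DirectedCycle.arc C i))

  ZeroSumFree : ∀ {n} → ArcLabelling Carrier n → Set ℓ
  ZeroSumFree {n} w = ¬ (Σ[ C ∈ DirectedCycle n ] cycleSum w C ≈ ε)

  HasZeroSumFreeLabelling : ℕ → Set (a ⊔ ℓ)
  HasZeroSumFreeLabelling n = Σ[ w ∈ ArcLabelling Carrier n ] ZeroSumFree w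

  -- Is-n A m is the relation "m = n(A)".  The minimum is over integers ≥ 2.

  record Is-n (m : ℕ) : Set (a ⊔ ℓ) where
    field
      2≤m         : 2 ≤ m
      noLabelling : ¬ HasZeroSumFreeLabelling m
      minimal     : ∀ k → 2 ≤ k → ¬ HasZeroSumFreeLabelling k → m ≤ k

-- The cyclic group of order n: residues 0, …, n - 1 under addition modulo n.

module _ (n : ℕ) .{{_ : NonZero n}} where
  private
    infixl 6 _⊕_

    _⊕_ : Fin n → Fin n → Fin n
    x ⊕ y = (toℕ x + toℕ y) mod n

    0# : Fin n
    0# = 0 mod n

    ⊖_ : Fin n → Fin n
    ⊖ x = (n ∸ toℕ x) mod n

    toℕ-% : ∀ (x : Fin n) → toℕ x % n ≡ toℕ x
    toℕ-% x = m<n⇒m%n≡m (toℕ<n x)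

    mod-⊕ : ∀ m x → (m mod n) ⊕ x ≡ (m + toℕ x) mod n
    mod-⊕ m x = toℕ-injective (begin
      toℕ ((m mod n) ⊕ x)           ≡⟨ toℕ-mod (toℕ (m mod n) + toℕ x) n ⟩
      (toℕ (m mod n) + toℕ x) % n   ≡⟨ cong (λ r → (r + toℕ x) % n) (toℕ-mod m n) ⟩
      (m % n + toℕ x) % n           ≡⟨ cong (λ r → (m % n + r) % n) (toℕ-% x) ⟨
      (m % n + toℕ x % n) % n       ≡⟨ %-distribˡ-+ m (toℕ x) n ⟨
      (m + toℕ x) % n               ≡⟨ toℕ-mod (m + toℕ x) n ⟨
      toℕ ((m + toℕ x) mod n)       ∎)

    ⊕-comm : Commutative _≡_ _⊕_
    ⊕-comm x y = cong (_mod n) (+-comm (toℕ x) (toℕ y))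

    ⊕-assoc : Associative _≡_ _⊕_
    ⊕-assoc x y z = begin
      (x ⊕ y) ⊕ z                          ≡⟨ mod-⊕ (toℕ x + toℕ y) z ⟩
      (toℕ x + toℕ y + toℕ z) mod n        ≡⟨ cong (_mod n) (+-assoc (toℕ x) _ _) ⟩
      (toℕ x + (toℕ y + toℕ z)) mod n      ≡⟨ cong (_mod n) (+-comm (toℕ x) _) ⟩
      (toℕ y + toℕ z + toℕ x) mod n        ≡⟨ mod-⊕ (toℕ y + toℕ z) x ⟨
      (y ⊕ z) ⊕ x                          ≡⟨ ⊕-comm (y ⊕ z) x ⟩
      x ⊕ (y ⊕ z)                          ∎

    ⊕-identityˡ : LeftIdentity _≡_ 0# _⊕_
    ⊕-identityˡ x = trans (mod-⊕ 0 x)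
      (toℕ-injective (trans (toℕ-mod (toℕ x) n) (toℕ-% x)))

    ⊕-inverseˡ : LeftInverse _≡_ 0# ⊖_ _⊕_
    ⊕-inverseˡ x = trans (mod-⊕ (n ∸ toℕ x) x) (toℕ-injective (begin
      toℕ ((n ∸ toℕ x + toℕ x) mod n)  ≡⟨ toℕ-mod (n ∸ toℕ x + toℕ x) n ⟩
      (n ∸ toℕ x + toℕ x) % n          ≡⟨ cong (_% n) (m∸n+n≡m (toℕ≤n x)) ⟩
      n % n                            ≡⟨ n%n≡0 n ⟩
      0                                ≡⟨ m*n%n≡0 0 n ⟨
      0 % n                            ≡⟨ toℕ-mod 0 n ⟨
      toℕ 0#                           ∎))

  ℤ/ : AbelianGroup 0ℓ 0ℓ
  ℤ/ = record
    { Carrier        = Fin n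
    ; _≈_            = _≡_
    ; _∙_            = _⊕_
    ; ε              = 0#
    ; _⁻¹            = ⊖_
    ; isAbelianGroup = record
      { isGroup = record
        { isMonoid = record
          { isSemigroup = record
            { isMagma = record { isEquivalence = isEquivalence ; ∙-cong = cong₂ _⊕_ }
            ; assoc   = ⊕-assoc
            }
          ; identity = ⊕-identityˡ , λ x → trans (⊕-comm x 0#) (⊕-identityˡ x)
          }
        ; inverse = ⊕-inverseˡ , λ x → trans (⊕-comm x (⊖ x)) (⊕-inverseˡ x)
        ; ⁻¹-cong = cong ⊖_
        }
      ; comm = ⊕-comm
      }
    }

{-# OPTIONS --safe #-}
module Submission where

-- In a zero-sum-free labelling, consider the paths into a fixed vertex s that start at t
-- and avoid a set R of spare vertices, and let L be the set of their sums.  For any three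
-- a, b, c ∈ R, one of them, say a, has three paths to t through {b, c} with distinct sums:
-- otherwise, after a change of potential making all arcs into t vanish, there is a digon
-- or a triangle of sum zero on {a, b, c}.  By the Cauchy–Davenport theorem, moving t to a
-- costs three spare vertices and enlarges L by two.  Hence 1 + 3 (p - 1) / 2 vertices
-- suffice for L to be all of ℤ/p, and then some path closes up to a zero-sum cycle.
-- For the minimality in n(A) constructively, labellings are searched exhaustively.

open import Algebra.Bundles using (AbelianGroup)
open import Algebra.Core using (Op₁; Op₂)
import Algebra.Definitions.RawMonoid as RawMonoidDefinitions
import Algebra.Properties.AbelianGroup as AbelianGroupProperties
import Algebra.Properties.CommutativeSemigroup as CommutativeSemigroupProperties
import Algebra.Properties.Monoid.Sum as MonoidSum
open import Algebra.Structures using (IsAbelianGroup)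
open import Data.Fin.Base using (Fin; zero; suc; toℕ; inject₁; fromℕ; fromℕ<)
open import Data.Fin.Properties as Fin
  using (toℕ<n; toℕ≤n; toℕ-inject₁; toℕ-fromℕ; toℕ-injective; injective⇒≤)
open import Data.List.Base using (List; []; _∷_; length; lookup; tabulate)
open import Data.List.Membership.DecPropositional using () renaming (_∈?_ to member?)
open import Data.List.Membership.Propositional using (_∈_; _∉_; lose; find)
open import Data.List.Membership.Propositional.Properties using (∈-lookup)
open import Data.List.Membership.Setoid.Properties using (index-injective)
open import Data.List.Properties using (length-tabulate)
open import Data.List.Relation.Binary.Permutation.Propositional using (↭-refl; ↭-sym; swap)
open import Data.List.Relation.Binary.Permutation.Propositional.Properties using (∈-resp-↭; shift)
open import Data.List.Relation.Binary.Subset.Propositional using (_⊆_)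
open import Data.List.Relation.Unary.All as All using (All; []; _∷_)
open import Data.List.Relation.Unary.All.Properties as All using (¬Any⇒All¬; All¬⇒¬Any)
open import Data.List.Relation.Unary.AllPairs using ([]; _∷_)
open import Data.List.Relation.Unary.Any as Any using (here; there; index)
open import Data.List.Relation.Unary.Unique.Propositional using (Unique)
import Data.List.Relation.Unary.Unique.Propositional.Properties as Unique
open import Data.Nat.Base
open import Data.Nat.Coprimality using (prime⇒coprime; coprime-Bézout)
open import Data.Nat.Divisibility using (_∣_; ∣⇒≤; m%n≡0⇒n∣m; n∣m⇒m%n≡0)
open import Data.Nat.DivMod
open import Data.Nat.GCD using (module Bézout)
open import Data.Nat.Primality using (Prime; euclidsLemma; prime⇒irreducible)
import Data.Nat.Properties as ℕ
open import Data.Nat.Tactic.RingSolver using (solve-∀)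
open import Data.Product.Base using (proj₁; proj₂; ∃; ∃₂; ∃-syntax; _×_; _,_)
open import Data.Sum.Base using (_⊎_; inj₁; inj₂)
open import Data.Vec.Base as Vec using (Vec; []; _∷_)
open import Data.Vec.Properties using (lookup∘tabulate)
open import Function.Base using (_∘_; case_of_)
open import Function.Definitions using (Injective)
open import Level using (0ℓ)
open import Relation.Binary.PropositionalEquality
open import Relation.Nullary using (¬_; Dec; yes; no; contradiction; ¬?; _×-dec_; _→-dec_)
open import Relation.Nullary.Decidable using (map′; decidable-stable)

open import Defs

private
  variable
    n q : ℕ

-- Duplicate-free lists in a finite type

lookup-injective : {A : Set} {xs : List A} → Unique xs → Injective _≡_ _≡_ (lookup xs)
lookup-injective {xs = _ ∷ _}  _        {zero}  {zero}  _  = refl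
lookup-injective {xs = _ ∷ xs} (x∉ ∷ _) {zero}  {suc j} eq =
  contradiction eq (All.lookup x∉ (∈-lookup {xs = xs} j))
lookup-injective {xs = _ ∷ xs} (x∉ ∷ _) {suc i} {zero}  eq =
  contradiction (sym eq) (All.lookup x∉ (∈-lookup {xs = xs} i))
lookup-injective {xs = _ ∷ _}  (_ ∷ u)  {suc i} {suc j} eq = cong suc (lookup-injective u eq)

covering⇒≤ : {L : List (Fin q)} → (∀ z → z ∈ L) → q ≤ length L
covering⇒≤ every = injective⇒≤ (index-injective (setoid _) (every _) (every _))

-- A missing `z` could be put in front of `L`, giving more than `q` distinct elements.
unique⇒covering : {L : List (Fin q)} → Unique L → q ≤ length L → ∀ z → z ∈ L
unique⇒covering {L = L} u q≤L z = decidable-stable (member? Fin._≟_ z L) λ z∉L →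
  ℕ.<⇒≱ (injective⇒≤ (lookup-injective (¬Any⇒All¬ L z∉L ∷ u))) q≤L

nonempty⇒∈ : {A : Set} {L : List A} → 1 ≤ length L → ∃ (_∈ L)
nonempty⇒∈ {L = x ∷ _} _ = x , here refl

-- Exhaustive search

Searchable : Set → Set₁
Searchable A = {P : A → Set} → (∀ a → Dec (P a)) → Dec (∃ P)

search-Vec : {A : Set} → Searchable A → ∀ n → Searchable (Vec A n)
search-Vec any? zero    P? = map′ ([] ,_) (λ {([] , p) → p}) (P? [])
search-Vec any? (suc n) P? =
  map′ (λ (x , xs , p) → x ∷ xs , p) (λ {(x ∷ xs , p) → x , xs , p})
    (any? λ x → search-Vec any? n λ xs → P? (x ∷ xs))

-- `d` is the distance left from `a` to the known witness `n`, so climbing one step at a time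
-- terminates.
least : {P : ℕ → Set} → (∀ k → Dec (P k)) → ∀ d {a n} → d + a ≡ n → P n →
        ∃[ m ] (a ≤ m × m ≤ n × P m × (∀ k → a ≤ k → P k → m ≤ k))
least P? d {a} refl Pn with P? a
... | yes Pa = a , ℕ.≤-refl , ℕ.m≤n+m a d , Pa , λ _ a≤k _ → a≤k
least P? zero    refl Pn | no ¬Pa = contradiction Pn ¬Pa
least P? (suc d) {a} refl Pn | no ¬Pa
  with m , a<m , m≤n , Pm , min ← least P? d (ℕ.+-suc d a) Pn
  = m , ℕ.<⇒≤ a<m , m≤n , Pm
  , λ k a≤k Pk → min k (ℕ.≤∧≢⇒< a≤k (λ {refl → ¬Pa Pk})) Pk

-- Cyclic successor and the counting of rounds

next-inject₁ : ∀ {k} (i : Fin (suc k)) → next (inject₁ i) ≡ suc i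
next-inject₁ {k} i = toℕ-injective (begin
  toℕ (next (inject₁ i))              ≡⟨ toℕ-mod (suc (toℕ (inject₁ i))) (2 + k) ⟩
  suc (toℕ (inject₁ i)) % (2 + k)     ≡⟨ cong (λ m → suc m % (2 + k)) (toℕ-inject₁ i) ⟩
  suc (toℕ i) % (2 + k)               ≡⟨ m<n⇒m%n≡m (s<s (toℕ<n i)) ⟩
  suc (toℕ i)                         ∎)
  where open ≡-Reasoning

next-fromℕ : ∀ k → next (fromℕ (suc k)) ≡ zero
next-fromℕ k = toℕ-injective (begin
  toℕ (next (fromℕ (suc k)))            ≡⟨ toℕ-mod (suc (toℕ (fromℕ (suc k)))) (2 + k) ⟩
  suc (toℕ (fromℕ (suc k))) % (2 + k)   ≡⟨ cong (λ m → suc m % (2 + k)) (toℕ-fromℕ (suc k)) ⟩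
  (2 + k) % (2 + k)                     ≡⟨ n%n≡0 (2 + k) ⟩
  0                                     ∎)
  where open ≡-Reasoning

-- Maintains the budget of the main induction: a round spends one unit of `h` and either gains two
-- elements or already fills the group.
enough-steps : ∀ h {k l} → q ≤ suc h * 2 + k → q ⊓ (2 + k) ≤ l → q ≤ h * 2 + l
enough-steps {q} h {k} {l} q≤ ⊓≤l = begin
  q                                    ≤⟨ ℕ.⊓-glb (ℕ.m≤n+m q (h * 2)) (subst (q ≤_) (regroup h k) q≤) ⟩
  (h * 2 + q) ⊓ (h * 2 + (2 + k))      ≡⟨ ℕ.+-distribˡ-⊓ (h * 2) q (2 + k) ⟨
  h * 2 + q ⊓ (2 + k)                  ≤⟨ ℕ.+-monoʳ-≤ (h * 2) ⊓≤l ⟩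
  h * 2 + l                            ∎
  where
    open ℕ.≤-Reasoning
    regroup : ∀ h k → suc h * 2 + k ≡ h * 2 + (2 + k)
    regroup = solve-∀

-- Path sums and cycles over a finite abelian group

module FiniteGroup {op : Op₂ (Fin q)} {e : Fin q} {inv : Op₁ (Fin q)}
                   (isAbelianGroup : IsAbelianGroup _≡_ op e inv) where

  G : AbelianGroup 0ℓ 0ℓ
  G = record { isAbelianGroup = isAbelianGroup }

  open AbelianGroup G
    using (_∙_; ε; _⁻¹; _-_; assoc; identityˡ; identityʳ; inverseˡ
          ; monoid; rawMonoid; commutativeSemigroup)
  open AbelianGroupProperties G
    using (∙-cancelˡ; ∙-cancelʳ; identityˡ-unique; //-rightDividesˡ; \\-leftDividesˡ)
  open CommutativeSemigroupProperties commutativeSemigroup using (x∙yz≈y∙xz)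
  open MonoidSum monoid using (sum; sum-cong-≗; sum-init-last)
  open RawMonoidDefinitions rawMonoid using () renaming (_×_ to _·_)
  open ≡-Reasoning

  -- Primality enters the combinatorial argument only through `Generates`, for the sumset bound, and
  -- `2-TorsionFree`, for the detours.
  Generates : Set
  Generates = ∀ {x} → x ≢ ε → ∀ y → ∃[ m ] m · x ≡ y

  2-TorsionFree : Set
  2-TorsionFree = ∀ {x} → x ∙ x ≡ ε → x ≡ ε

  _∈?_ : (x : Fin q) (L : List (Fin q)) → Dec (x ∈ L)
  _∈?_ = member? Fin._≟_

  Matrix : ℕ → Set
  Matrix n = Fin n → Fin n → Fin q

  -- Vertex lists x ∷ l stand for the path starting at x; its end is endpoint x l.

  pathSum : Matrix n → Fin n → List (Fin n) → Fin q
  pathSum W x []      = ε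
  pathSum W x (y ∷ l) = W x y ∙ pathSum W y l

  endpoint : Fin n → List (Fin n) → Fin n
  endpoint x []      = x
  endpoint x (y ∷ l) = endpoint y l

  NoZeroCycle : Matrix n → Set
  NoZeroCycle W = ∀ x y l → Unique (x ∷ y ∷ l) →
                  pathSum W x (y ∷ l) ∙ W (endpoint y l) x ≢ ε

  sum-lookup : (W : Matrix n) (x : Fin n) (l : List (Fin n)) →
               sum (λ i → W (lookup (x ∷ l) (inject₁ i)) (lookup l i)) ≡ pathSum W x l
  sum-lookup W x []      = refl
  sum-lookup W x (y ∷ l) = cong (W x y ∙_) (sum-lookup W y l)

  lookup-last : (x : Fin n) (l : List (Fin n)) → lookup (x ∷ l) (fromℕ (length l)) ≡ endpoint x l
  lookup-last x []      = refl
  lookup-last x (y ∷ l) = lookup-last y l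

  -- The diagonal value `ε` is a filler: cycles through distinct vertices never read it.
  toMatrix : ArcLabelling (Fin q) n → Matrix n
  toMatrix w x y with x Fin.≟ y
  ... | yes _   = ε
  ... | no  x≢y = w ((x , y) , x≢y)

  toMatrix-arc : (w : ArcLabelling (Fin q) n) ((xy , x≢y) : Arc n) →
                 toMatrix w (proj₁ xy) (proj₂ xy) ≡ w (xy , x≢y)
  toMatrix-arc w ((x , y) , x≢y) with x Fin.≟ y
  ... | yes x≡y = contradiction x≡y x≢y
  ... | no  _   = refl

  -- All positions of the vertex list but the last give the arcs of the path; the last, where `next`
  -- wraps to `zero`, gives the closing arc.
  zeroSumFree⇒noZeroCycle : {w : ArcLabelling (Fin q) n} → ZeroSumFree G w →
                            NoZeroCycle (toMatrix w)
  zeroSumFree⇒noZeroCycle {w = w} free x y l unique zero-sum = free (C , (begin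
    cycleSum G w C                              ≡⟨ sum-cong-≗ (λ i → toMatrix-arc w (arc i)) ⟨
    sum step                                    ≡⟨ sum-init-last step ⟩
    sum (step ∘ inject₁) ∙ step (fromℕ (length l′))
      ≡⟨ cong₂ _∙_ (trans (sum-cong-≗ (λ i → cong (W (v (inject₁ i)) ∘ v) (next-inject₁ i)))
                          (sum-lookup W x l′))
                   (cong₂ W (lookup-last x l′) (cong v (next-fromℕ (length l)))) ⟩
    pathSum W x l′ ∙ W (endpoint y l) x         ≡⟨ zero-sum ⟩
    ε                                           ∎))
    where
      W = toMatrix w
      l′ = y ∷ l
      v = lookup (x ∷ l′)
      C = record { extra = length l ; vertex = v ; injective = lookup-injective unique }
      open DirectedCycle C using (arc)
      step = λ i → W (v i) (v (next i))

  -- Deciding whether a labelling exists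

  -- Arc n carries a proof of x ≢ y, but such proofs are definitionally equal,
  -- so a labelling amounts to a table of values and can be searched for.

  module _ (n : ℕ) where
    Table : Set
    Table = Vec (Vec (Fin q) n) n

    entry : Table → Matrix n
    entry M x y = Vec.lookup (Vec.lookup M x) y

    ZeroCycle : Table → ∀ {k} → (Fin (2 + k) → Fin n) → Set
    ZeroCycle M v = (∀ i j → v i ≡ v j → i ≡ j) × sum (λ i → entry M (v i) (v (next i))) ≡ ε

    zeroCycle? : ∀ M {k} (v : Fin (2 + k) → Fin n) → Dec (ZeroCycle M v)
    zeroCycle? M v =
      Fin.all? (λ i → Fin.all? λ j → (v i Fin.≟ v j) →-dec (i Fin.≟ j)) ×-dec (_ Fin.≟ _)

    -- The search yields vertices as vectors, which match a given vertex map only pointwise.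
    zeroCycle-cong : ∀ M {k} {v v′ : Fin (2 + k) → Fin n} → (∀ i → v i ≡ v′ i) →
                     ZeroCycle M v → ZeroCycle M v′
    zeroCycle-cong M v≗v′ (inj , sum≡ε) =
      (λ i j eq → inj i j (trans (v≗v′ i) (trans eq (sym (v≗v′ j)))))
      , trans (sum-cong-≗ (λ i → sym (cong₂ (entry M) (v≗v′ i) (v≗v′ (next i))))) sum≡ε

    -- Finitely many lengths suffice: the `2 + extra` vertices of a cycle are distinct, so
    -- `extra < n`.
    ZeroCycleOf : Table → Fin n → Set
    ZeroCycleOf M k = ∃[ v ] ZeroCycle M {toℕ k} (Vec.lookup v)

    entryLabelling : Table → ArcLabelling (Fin q) n
    entryLabelling M ((x , y) , _) = entry M x y

    table : ArcLabelling (Fin q) n → Table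
    table w = Vec.tabulate λ x → Vec.tabulate (toMatrix w x)

    entry-table : ∀ w x y → entry (table w) x y ≡ toMatrix w x y
    entry-table w x y =
      trans (cong (λ r → Vec.lookup r y) (lookup∘tabulate _ x)) (lookup∘tabulate _ y)

    hasZeroSumFreeLabelling? : Dec (HasZeroSumFreeLabelling G n)
    hasZeroSumFreeLabelling? = map′ to from
      (search-Vec (search-Vec Fin.any? n) n λ M →
        ¬? (Fin.any? {P = ZeroCycleOf M} λ k →
          search-Vec Fin.any? (2 + toℕ k) λ v → zeroCycle? M (Vec.lookup v)))
      where
        to : (∃[ M ] ¬ ∃ (ZeroCycleOf M)) → HasZeroSumFreeLabelling G n
        to (M , none) = entryLabelling M , λ (C , sum≡ε) →
          let open DirectedCycle C
              extra<n = ℕ.<⇒≤ (injective⇒≤ injective)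
          in case fromℕ< extra<n , Fin.toℕ-fromℕ< extra<n of λ
            { (k , toℕk≡extra) → none (k , aux C sum≡ε toℕk≡extra) }
          where
            aux : ∀ C → cycleSum G (entryLabelling M) C ≡ ε → ∀ {k} → toℕ k ≡ DirectedCycle.extra C →
                  ZeroCycleOf M k
            aux record { vertex = v ; injective = inj } sum≡ε refl =
              Vec.tabulate v ,
              zeroCycle-cong M (λ i → sym (lookup∘tabulate v i)) ((λ _ _ → inj) , sum≡ε)

        from : HasZeroSumFreeLabelling G n → ∃[ M ] ¬ ∃ (ZeroCycleOf M)
        from (w , free) = table w , λ (k , v , inj , sum≡ε) →
          let C = record { extra = toℕ k ; vertex = Vec.lookup v ; injective = inj _ _ }
              u = Vec.lookup v
          in free (C , trans (sum-cong-≗ λ i →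
               sym (trans (entry-table w (u i) (u (next i)))
                          (toMatrix-arc w (DirectedCycle.arc C i)))) sum≡ε)

  -- Since existence of a labelling is decidable, testing the sizes from 2 up to `n` finds the least
  -- one without a labelling.
  ¬labelling⇒Is-n : 2 ≤ n → ¬ HasZeroSumFreeLabelling G n → ∃[ m ] (Is-n G m × m ≤ n)
  ¬labelling⇒Is-n {n} 2≤n none =
    let m , 2≤m , m≤n , noLabelling , minimal =
          least {P = λ k → ¬ HasZeroSumFreeLabelling G k}
                (λ k → ¬? (hasZeroSumFreeLabelling? k)) (n ∸ 2) (ℕ.m∸n+n≡m 2≤n) none
    in m , record { 2≤m = 2≤m ; noLabelling = noLabelling ; minimal = minimal } , m≤n

  -- Sumsets with three-element sets

  module _ (generates : Generates) where

    -- A nonempty `L` closed under adding `x` contains `σ` plus every multiple of `x`, hence the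
    -- whole group, against `length L < q`.
    escape : ∀ {x L} → x ≢ ε → 1 ≤ length L → length L < q → ∃[ σ ] (σ ∈ L × x ∙ σ ∉ L)
    escape {x} {L} x≢ε 1≤L L<q with Any.any? (λ σ → ¬? ((x ∙ σ) ∈? L)) L
    ... | yes escapes = find escapes
    ... | no  closed  = contradiction (covering⇒≤ every) (ℕ.<⇒≱ L<q)
      where
        multiples : ∀ m {σ} → σ ∈ L → m · x ∙ σ ∈ L
        multiples zero    σ∈L = subst (_∈ L) (sym (identityˡ _)) σ∈L
        multiples (suc m) {σ} σ∈L = subst (_∈ L) (sym (assoc x (m · x) σ))
          (decidable-stable (_ ∈? L) λ ∉L → closed (lose (multiples m σ∈L) ∉L))

        every : ∀ z → z ∈ L
        every z with σ , σ∈L ← nonempty⇒∈ 1≤L with m , mx≡ ← generates x≢ε (z - σ) =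
          subst (_∈ L) (trans (cong (_∙ σ) mx≡) (//-rightDividesˡ σ z)) (multiples m σ∈L)

    -- The Cauchy–Davenport bound for L + {0, x, y}, by Dyson's transform: choose σ ∈ L
    -- with x + σ ∉ L.  If y + σ ∉ L, both are new.  Otherwise all of (L ∪ {x + σ}) + {0, y}
    -- lies in the sumset, and one more element is gained by a shift by y.

    cauchyDavenport₃ : ∀ {x y L} {Q : Fin q → Set} → x ≢ ε → y ≢ ε → x ≢ y →
      Unique L → 1 ≤ length L →
      (∀ {σ} → σ ∈ L → Q σ × Q (x ∙ σ) × Q (y ∙ σ)) →
      ∃[ L′ ] (Unique L′ × All Q L′ × q ⊓ (2 + length L) ≤ length L′)
    cauchyDavenport₃ {x} {y} {L} {Q} x≢ε y≢ε x≢y unique 1≤L QL with q ℕ.≤? length L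
    ... | yes q≤L = L , unique , All.tabulate (proj₁ ∘ QL) , ℕ.≤-trans (ℕ.m⊓n≤m q _) q≤L
    ... | no  q≰L
      with σ , σ∈L , xσ∉L ← escape x≢ε 1≤L (ℕ.≰⇒> q≰L)
      with unique′ ← ¬Any⇒All¬ L xσ∉L ∷ unique
         | QL′ ← proj₁ (proj₂ (QL σ∈L)) ∷ All.tabulate (proj₁ ∘ QL)
      with (y ∙ σ) ∈? (x ∙ σ ∷ L)
    ... | no yσ∉ = y ∙ σ ∷ x ∙ σ ∷ L , ¬Any⇒All¬ _ yσ∉ ∷ unique′
                 , proj₂ (proj₂ (QL σ∈L)) ∷ QL′ , ℕ.m⊓n≤n q _
    ... | yes (here yσ≡xσ) = contradiction (sym (∙-cancelʳ σ y x yσ≡xσ)) x≢y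
    ... | yes (there yσ∈L) with q ℕ.≤? suc (length L)
    ...   | yes q≤1+L = x ∙ σ ∷ L , unique′ , QL′ , ℕ.≤-trans (ℕ.m⊓n≤m q _) q≤1+L
    ...   | no  q≰1+L with τ , τ∈ , yτ∉ ← escape y≢ε (s≤s z≤n) (ℕ.≰⇒> q≰1+L)
      = y ∙ τ ∷ x ∙ σ ∷ L , ¬Any⇒All¬ _ yτ∉ ∷ unique′ , Qyτ τ∈ ∷ QL′ , ℕ.m⊓n≤n q _
      where
        Qyτ : τ ∈ x ∙ σ ∷ L → Q (y ∙ τ)
        -- This is the gain of the transform: y + (x + σ) = x + (y + σ), and y + σ already lies in
        -- `L`.
        Qyτ (here refl)  = subst Q (x∙yz≈y∙xz x y σ) (proj₁ (proj₂ (QL yσ∈L)))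
        Qyτ (there τ∈L) = proj₂ (proj₂ (QL τ∈L))

  -- Potentials

  -- The potential d changes no cycle sum; d x = W x t makes all arcs into t vanish.

  gauge : Matrix n → (Fin n → Fin q) → Matrix n
  gauge W d x y = (W x y ∙ d y) - d x

  -- Passing the arc trades `d x` for `d y`; the tail `τ` allows chaining along a path.
  gauge-arc : ∀ (W : Matrix n) d x y τ → d x ∙ (gauge W d x y ∙ τ) ≡ W x y ∙ (d y ∙ τ)
  gauge-arc W d x y τ = begin
    d x ∙ (gauge W d x y ∙ τ)  ≡⟨ x∙yz≈y∙xz (d x) (gauge W d x y) τ ⟩
    gauge W d x y ∙ (d x ∙ τ)  ≡⟨ assoc _ _ _ ⟨
    gauge W d x y ∙ d x ∙ τ    ≡⟨ cong (_∙ τ) (//-rightDividesˡ (d x) (W x y ∙ d y)) ⟩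
    W x y ∙ d y ∙ τ            ≡⟨ assoc _ _ _ ⟩
    W x y ∙ (d y ∙ τ)          ∎

  -- The potentials of the interior vertices telescope.
  gauge-path : ∀ (W : Matrix n) d x l τ →
               d x ∙ (pathSum (gauge W d) x l ∙ τ) ≡ pathSum W x l ∙ (d (endpoint x l) ∙ τ)
  gauge-path W d x []      τ = x∙yz≈y∙xz (d x) ε τ
  gauge-path W d x (y ∷ l) τ = begin
    d x ∙ (gauge W d x y ∙ pathSum (gauge W d) y l ∙ τ)    ≡⟨ cong (d x ∙_) (assoc _ _ _) ⟩
    d x ∙ (gauge W d x y ∙ (pathSum (gauge W d) y l ∙ τ))  ≡⟨ gauge-arc W d x y _ ⟩
    W x y ∙ (d y ∙ (pathSum (gauge W d) y l ∙ τ))          ≡⟨ cong (W x y ∙_) (gauge-path W d y l τ) ⟩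
    W x y ∙ (pathSum W y l ∙ (d (endpoint y l) ∙ τ))       ≡⟨ assoc _ _ _ ⟨
    W x y ∙ pathSum W y l ∙ (d (endpoint y l) ∙ τ)         ∎

  -- Around a cycle the potential starts and ends at `d x`, so the original cycle sum would fix
  -- `d x` and therefore vanish.
  gauge-noZeroCycle : {W : Matrix n} (d : Fin n → Fin q) → NoZeroCycle W → NoZeroCycle (gauge W d)
  gauge-noZeroCycle {W = W} d noZero x y l unique zero-sum =
    noZero x y l unique (identityˡ-unique _ (d x) (begin
      P ∙ W z x ∙ d x                ≡⟨ assoc _ _ _ ⟩
      P ∙ (W z x ∙ d x)              ≡⟨ cong (λ τ → P ∙ (W z x ∙ τ)) (identityʳ (d x)) ⟨
      P ∙ (W z x ∙ (d x ∙ ε))        ≡⟨ cong (P ∙_) (gauge-arc W d z x ε) ⟨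
      P ∙ (d z ∙ (gauge W d z x ∙ ε)) ≡⟨ cong (λ τ → P ∙ (d z ∙ τ)) (identityʳ _) ⟩
      P ∙ (d z ∙ gauge W d z x)      ≡⟨ gauge-path W d x (y ∷ l) _ ⟨
      d x ∙ (pathSum (gauge W d) x (y ∷ l) ∙ gauge W d z x) ≡⟨ cong (d x ∙_) zero-sum ⟩
      d x ∙ ε                        ≡⟨ identityʳ (d x) ⟩
      d x                            ∎))
    where
      z = endpoint y l
      P = pathSum W x (y ∷ l)

  -- Three distinct sums from one of three vertices

  -- The third sum is `ε`, which belongs to the direct arc into `t` once all arcs into `t` vanish.
  ThreeSums : List (Fin q) → Set
  ThreeSums vs = ∃₂ λ x y → x ≢ ε × y ≢ ε × x ≢ y × x ∈ vs × y ∈ vs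

  threeSums? : ∀ vs → Dec (ThreeSums vs)
  threeSums? vs = Fin.any? λ x → Fin.any? λ y →
    ¬? (x Fin.≟ ε) ×-dec ¬? (y Fin.≟ ε) ×-dec ¬? (x Fin.≟ y) ×-dec (x ∈? vs) ×-dec (y ∈? vs)

  ¬threeSums⇒≡ : ∀ {vs x y} → ¬ ThreeSums vs → x ∈ vs → y ∈ vs → x ≢ ε → y ≢ ε → x ≡ y
  ¬threeSums⇒≡ {x = x} {y} ¬three x∈ y∈ x≢ε y≢ε = decidable-stable (x Fin.≟ y) λ x≢y →
    ¬three (x , y , x≢ε , y≢ε , x≢y , x∈ , y∈)

  -- The sums of the paths from a to t other than a → t with interior in {b, c}, when all
  -- arcs into t vanish.

  detours : Matrix n → (a b c : Fin n) → List (Fin q)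
  detours U a b c = U a b ∷ U a c ∷ U a b ∙ U b c ∷ U a c ∙ U c b ∷ []

  module _ (2-torsion-free : 2-TorsionFree) where

    -- Read `x` as the common label of a → b and a → c, and `ca`, `cb` as the arcs leaving c, so
    -- that `cb` is - x. A nonzero `ca` would equal `cb` and form a zero digon with a → c. So `ca`
    -- vanishes, and the path c → a → b has the nonzero sum x, which must equal `cb`; then x = - x,
    -- impossible without 2-torsion.
    no-return : ∀ {x ca cb} → x ≢ ε → x ∙ ca ≢ ε → x ∙ cb ≡ ε →
                (cb ≢ ε → ca ≢ ε → cb ≡ ca) → ¬ (cb ≢ ε → ca ∙ x ≢ ε → cb ≡ ca ∙ x)
    no-return {x} {ca} {cb} x≢ε x+ca≢ε x+cb≡ε cb≡ca cb≡ca+x = case ca Fin.≟ ε of λ where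
        (no ca≢ε)  → x+ca≢ε (trans (cong (x ∙_) (sym (cb≡ca cb≢ε ca≢ε))) x+cb≡ε)
        (yes ca≡ε) →
          let ca+x≡x = trans (cong (_∙ x) ca≡ε) (identityˡ x)
              cb≡x   = trans (cb≡ca+x cb≢ε (x≢ε ∘ trans (sym ca+x≡x))) ca+x≡x
          in x≢ε (2-torsion-free (trans (cong (x ∙_) (sym cb≡x)) x+cb≡ε))
      where
        cb≢ε : cb ≢ ε
        cb≢ε cb≡ε = x≢ε (trans (sym (identityʳ x)) (trans (cong (x ∙_) (sym cb≡ε)) x+cb≡ε))

    -- If ab and ac are nonzero, they equal the same x.  As abc and acb are 0 or x and bcb ≢ 0,
    -- one of bc, cb is - x, and the detours from its start are too many by no-return.

    vanishing-arc : ∀ (U : Matrix n) {a b c} →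
      U a b ∙ U b a ≢ ε → U a c ∙ U c a ≢ ε → U b c ∙ U c b ≢ ε →
      ¬ ThreeSums (detours U a b c) → ¬ ThreeSums (detours U b c a) → ¬ ThreeSums (detours U c a b) →
      U a b ≡ ε ⊎ U a c ≡ ε
    vanishing-arc U {a} {b} {c} aba≢ε aca≢ε bcb≢ε ¬a ¬b ¬c
      with U a b Fin.≟ ε | U a c Fin.≟ ε
    ... | yes ab≡ε | _        = inj₁ ab≡ε
    ... | no  _    | yes ac≡ε = inj₂ ac≡ε
    ... | no  ab≢ε | no  ac≢ε
      with ab≡ac ← ¬threeSums⇒≡ ¬a (here refl) (there (here refl)) ab≢ε ac≢ε
      with (U a b ∙ U b c) Fin.≟ ε | (U a c ∙ U c b) Fin.≟ ε
    ... | yes abc≡ε | _ = contradiction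
        (λ bc≢ε ba+ab≢ε → trans
          (¬threeSums⇒≡ ¬b (here refl) (there (there (there (here refl)))) bc≢ε
            (ba+ab≢ε ∘ trans (cong (U b a ∙_) ab≡ac)))
          (cong (U b a ∙_) (sym ab≡ac)))
        (no-return ab≢ε aba≢ε abc≡ε (¬threeSums⇒≡ ¬b (here refl) (there (here refl))))
    ... | no _ | yes acb≡ε = contradiction
        (λ cb≢ε ca+ac≢ε → trans
          (¬threeSums⇒≡ ¬c (there (here refl)) (there (there (here refl))) cb≢ε
            (ca+ac≢ε ∘ trans (cong (U c a ∙_) (sym ab≡ac))))
          (cong (U c a ∙_) ab≡ac))
        (no-return ac≢ε aca≢ε acb≡ε (¬threeSums⇒≡ ¬c (there (here refl)) (here refl)))
    ... | no abc≢ε | no acb≢ε = contradiction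
        (trans (cong₂ _∙_ bc≡ε cb≡ε) (identityˡ ε)) bcb≢ε
      where
        bc≡ε : U b c ≡ ε
        bc≡ε = ∙-cancelˡ (U a b) _ _ (trans
          (¬threeSums⇒≡ ¬a (there (there (here refl))) (here refl) abc≢ε ab≢ε)
          (sym (identityʳ _)))
        cb≡ε : U c b ≡ ε
        cb≡ε = ∙-cancelˡ (U a c) _ _ (trans
          (¬threeSums⇒≡ ¬a (there (there (there (here refl)))) (there (here refl)) acb≢ε ac≢ε)
          (sym (identityʳ _)))

    -- If all three fail, `vanishing-arc` gives each vertex a vanishing arc to one of the other two.
    -- Following these arcs closes a digon or a triangle of sum zero.
    threeSums : ∀ {U : Matrix n} {a b c} → NoZeroCycle U → a ≢ b → a ≢ c → b ≢ c →
      ThreeSums (detours U a b c) ⊎ ThreeSums (detours U b c a) ⊎ ThreeSums (detours U c a b)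
    threeSums {U = U} {a} {b} {c} noZero a≢b a≢c b≢c
      with threeSums? (detours U a b c) | threeSums? (detours U b c a) | threeSums? (detours U c a b)
    ... | yes three | _         | _         = inj₁ three
    ... | no _      | yes three | _         = inj₂ (inj₁ three)
    ... | no _      | no _      | yes three = inj₂ (inj₂ three)
    ... | no ¬a     | no ¬b     | no ¬c     = impossible
      where
        digon : ∀ {x y} → x ≢ y → U x y ∙ U y x ≢ ε
        digon {x} {y} x≢y eq = noZero x y [] ((x≢y ∷ []) ∷ [] ∷ [])
          (trans (cong (_∙ U y x) (identityʳ (U x y))) eq)

        triangle : ∀ {x y z} → x ≢ y → x ≢ z → y ≢ z →
                   U x y ≡ ε → U y z ≡ ε → U z x ≡ ε → ∀ {A : Set} → A
        triangle {x} {y} {z} x≢y x≢z y≢z xy yz zx = contradiction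
          (trans (cong₂ _∙_ (cong₂ _∙_ xy (cong (_∙ ε) yz)) zx)
                 (trans (identityʳ _) (trans (identityˡ _) (identityˡ ε))))
          (noZero x y (z ∷ []) ((x≢y ∷ x≢z ∷ []) ∷ (y≢z ∷ []) ∷ [] ∷ []))

        both : ∀ {x y} → x ≢ y → U x y ≡ ε → U y x ≡ ε → ∀ {A : Set} → A
        both x≢y xy yx = contradiction (trans (cong₂ _∙_ xy yx) (identityˡ ε)) (digon x≢y)

        impossible : ∀ {A : Set} → A
        impossible
          with vanishing-arc U (digon a≢b) (digon a≢c) (digon b≢c) ¬a ¬b ¬c
             | vanishing-arc U (digon b≢c) (digon (≢-sym a≢b)) (digon (≢-sym a≢c)) ¬b ¬c ¬a
             | vanishing-arc U (digon (≢-sym a≢c)) (digon (≢-sym b≢c)) (digon a≢b) ¬c ¬a ¬b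
        ... | inj₁ ab | inj₂ ba | _       = both a≢b ab ba
        ... | inj₂ ac | _       | inj₁ ca = both a≢c ac ca
        ... | _       | inj₁ bc | inj₂ cb = both b≢c bc cb
        ... | inj₁ ab | inj₁ bc | inj₁ ca = triangle a≢b a≢c b≢c ab bc ca
        ... | inj₂ ac | inj₂ ba | inj₂ cb = triangle a≢c a≢b (≢-sym b≢c) ac cb ba

  -- Path sums into a fixed vertex

  module _ (W : Matrix n) (s : Fin n) where

    Reach : List (Fin n) → Fin n → Fin q → Set
    Reach R t σ = ∃[ l ] (endpoint t l ≡ s × Unique (t ∷ l) × All (_∉ R) (t ∷ l) × pathSum W t l ≡ σ)

    -- The path avoids `x` because `x` was spare, so its vertices stay distinct when `x` is put in
    -- front.
    extend : ∀ {R t x σ} → x ∉ R → Reach (x ∷ R) t σ → Reach R x (W x t ∙ σ)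
    extend {t = t} {x} x∉R (l , end , unique , avoids , sum≡) =
      t ∷ l , end , All.map (λ y∉ x≡y → y∉ (here (sym x≡y))) avoids ∷ unique
      , x∉R ∷ All.map (_∘ there) avoids , cong (W x t ∙_) sum≡

    weaken : ∀ {R R′ t σ} → R ⊆ R′ → Reach R′ t σ → Reach R t σ
    weaken R⊆R′ (l , end , unique , avoids , sum≡) =
      l , end , unique , All.map (_∘ R⊆R′) avoids , sum≡

    -- Adding `W a t` undoes the gauge, turning `v` into the true sum of a path from `a` to `t`.
    -- That path is put in front of the given one, which it meets only in `t` since `a`, `b`, `c`
    -- were spare.
    detour-reach : ∀ {R t a b c τ v} → Unique (a ∷ b ∷ c ∷ R) → Reach (a ∷ b ∷ c ∷ R) t τ →
                   v ∈ ε ∷ detours (gauge W (λ x → W x t)) a b c → Reach R a (W a t ∙ (v ∙ τ))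
    detour-reach {R} {t} {a} {b} {c} {τ}
      ((a≢b ∷ a≢c ∷ a#R) ∷ (b≢c ∷ b#R) ∷ c#R ∷ _) reach = λ where
        (here refl) → subst (Reach R a) (cong (W a t ∙_) (sym (identityˡ τ)))
          (extend a∉R (weaken (λ { (here e) → here e ; (there i) → there (there (there i)) }) reach))
        (there (here refl)) → subst (Reach R a) (sym (arc a b τ))
          (extend a∉R (extend b∉aR (weaken baR⊆abcR reach)))
        (there (there (here refl))) → subst (Reach R a) (sym (arc a c τ))
          (extend a∉R (extend c∉aR (weaken caR⊆abcR reach)))
        (there (there (there (here refl)))) → subst (Reach R a) (sym (two-arcs b c))
          (extend a∉R (extend b∉aR (extend c∉baR (weaken cbaR⊆abcR reach))))
        (there (there (there (there (here refl))))) → subst (Reach R a) (sym (two-arcs c b))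
          (extend a∉R (extend c∉aR (extend b∉caR (weaken bcaR⊆abcR reach))))
      where
        arc = gauge-arc W (λ x → W x t)

        two-arcs : ∀ x y → W a t ∙ (gauge W (λ x → W x t) a x ∙ gauge W (λ x → W x t) x y ∙ τ) ≡
                           W a x ∙ (W x y ∙ (W y t ∙ τ))
        two-arcs x y = begin
          W a t ∙ (u a x ∙ u x y ∙ τ)    ≡⟨ cong (W a t ∙_) (assoc _ _ τ) ⟩
          W a t ∙ (u a x ∙ (u x y ∙ τ))  ≡⟨ arc a x _ ⟩
          W a x ∙ (W x t ∙ (u x y ∙ τ))  ≡⟨ cong (W a x ∙_) (arc x y τ) ⟩
          W a x ∙ (W x y ∙ (W y t ∙ τ))  ∎
          where u = gauge W (λ x → W x t)

        a∉R = All¬⇒¬Any a#R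
        b∉aR = All¬⇒¬Any (≢-sym a≢b ∷ b#R)
        c∉aR = All¬⇒¬Any (≢-sym a≢c ∷ c#R)
        c∉baR = All¬⇒¬Any (≢-sym b≢c ∷ ≢-sym a≢c ∷ c#R)
        b∉caR = All¬⇒¬Any (b≢c ∷ ≢-sym a≢b ∷ b#R)

        bcaR⊆abcR : b ∷ c ∷ a ∷ R ⊆ a ∷ b ∷ c ∷ R
        bcaR⊆abcR = ∈-resp-↭ (shift a (b ∷ c ∷ []) R)

        cbaR⊆abcR : c ∷ b ∷ a ∷ R ⊆ a ∷ b ∷ c ∷ R
        cbaR⊆abcR = bcaR⊆abcR ∘ ∈-resp-↭ (swap c b ↭-refl)

        baR⊆abcR : b ∷ a ∷ R ⊆ a ∷ b ∷ c ∷ R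
        baR⊆abcR = cbaR⊆abcR ∘ there

        caR⊆abcR : c ∷ a ∷ R ⊆ a ∷ b ∷ c ∷ R
        caR⊆abcR = bcaR⊆abcR ∘ there

    -- Sums are recorded up to an offset `g`, which absorbs the label of the direct arc when the
    -- start of the paths moves.
    Next : List (Fin n) → ℕ → Set
    Next R k = ∃[ t ] ∃[ g ] ∃[ L ]
      (t ≢ s × Unique L × All (λ σ → Reach R t (g ∙ σ)) L × q ⊓ (2 + k) ≤ length L)

    -- Up to the offset `W a t ∙ g`, everything in L + {0, x, y} is reached from `a`, so
    -- `cauchyDavenport₃` applies.
    advance : Generates →
      ∀ {R t a b c g L} → Unique (a ∷ b ∷ c ∷ R) → s ≢ a → Unique L → 1 ≤ length L →
      All (λ σ → Reach (a ∷ b ∷ c ∷ R) t (g ∙ σ)) L →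
      ThreeSums (detours (gauge W (λ x → W x t)) a b c) → Next R (length L)
    advance generates {R} {t} {a} {b} {c} {g} {L} uniqueR s≢a uniqueL 1≤L reach
      (x , y , x≢ε , y≢ε , x≢y , x∈ , y∈)
      =
      let L′ , uniqueL′ , reach′ , bound =
            cauchyDavenport₃ generates {Q = Q} x≢ε y≢ε x≢y uniqueL 1≤L λ σ∈L →
              subst Q (identityˡ _) (shifted (here refl) σ∈L)
              , shifted (there x∈) σ∈L , shifted (there y∈) σ∈L
      in a , W a t ∙ g , L′ , ≢-sym s≢a , uniqueL′ , reach′ , bound
      where
        Q : Fin q → Set
        Q σ = Reach R a (W a t ∙ g ∙ σ)

        shifted : ∀ {v σ} → v ∈ ε ∷ detours (gauge W (λ x → W x t)) a b c → σ ∈ L → Q (v ∙ σ)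
        shifted {v} {σ} v∈ σ∈L = subst (Reach R a)
          (trans (cong (W a t ∙_) (x∙yz≈y∙xz v g σ)) (sym (assoc _ _ _)))
          (detour-reach uniqueR (All.lookup reach σ∈L) v∈)

    -- `advance` moves to the first spare vertex; if `threeSums` selects another one, the triple is
    -- rotated.
    next-end : Generates → 2-TorsionFree → NoZeroCycle W → ∀ {R t a b c g L} →
      Unique (a ∷ b ∷ c ∷ R) → s ∉ a ∷ b ∷ c ∷ R → Unique L → 1 ≤ length L →
      All (λ σ → Reach (a ∷ b ∷ c ∷ R) t (g ∙ σ)) L → Next R (length L)
    next-end generates 2-torsion-free noZero {R} {t} {a} {b} {c}
      unique@((a≢b ∷ a≢c ∷ a∉R) ∷ (b≢c ∷ b∉R) ∷ c∉R ∷ uniqueR) s∉ uniqueL 1≤L reach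
      with threeSums 2-torsion-free (gauge-noZeroCycle (λ x → W x t) noZero) a≢b a≢c b≢c
    ... | inj₁ abc = advance generates unique (s∉ ∘ here) uniqueL 1≤L reach abc
    ... | inj₂ (inj₁ bca) = advance generates
        ((b≢c ∷ ≢-sym a≢b ∷ b∉R) ∷ (≢-sym a≢c ∷ c∉R) ∷ a∉R ∷ uniqueR)
        (s∉ ∘ there ∘ here) uniqueL 1≤L (All.map (weaken rotate) reach) bca
      where
        rotate : b ∷ c ∷ a ∷ R ⊆ a ∷ b ∷ c ∷ R
        rotate = ∈-resp-↭ (shift a (b ∷ c ∷ []) R)
    ... | inj₂ (inj₂ cab) = advance generates
        ((≢-sym a≢c ∷ ≢-sym b≢c ∷ c∉R) ∷ (a≢b ∷ a∉R) ∷ b∉R ∷ uniqueR)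
        (s∉ ∘ there ∘ there ∘ here) uniqueL 1≤L (All.map (weaken rotate) reach) cab
      where
        rotate : c ∷ a ∷ b ∷ R ⊆ a ∷ b ∷ c ∷ R
        rotate = ∈-resp-↭ (↭-sym (shift c (a ∷ b ∷ []) R))

    -- If `L` were the whole group, some path from `t` to `s` would have sum - `W s t`, and the arc
    -- from `s` to `t` would close it to a zero cycle.
    close : NoZeroCycle W → 2 ≤ q → ∀ {R t g L} → Unique L → (t ≡ s → length L ≤ 1) →
      All (λ σ → Reach R t (g ∙ σ)) L → length L < q
    close noZero 2≤q {R} {t} {g} {L} uniqueL t≡s⇒L≤1 reach = ℕ.≰⇒> λ q≤L →
      case All.lookup reach (unique⇒covering uniqueL q≤L (g ⁻¹ ∙ W s t ⁻¹)) of λ where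
        -- The empty path has no closing arc; it forces `t ≡ s`, where `L` is too short to cover the
        -- group.
        ([]    , t≡s , _) → ℕ.<⇒≱ 2≤q (ℕ.≤-trans q≤L (t≡s⇒L≤1 t≡s))
        (y ∷ l , end , unique , _ , sum≡) → noZero t y l unique (begin
          pathSum W t (y ∷ l) ∙ W (endpoint y l) t  ≡⟨ cong₂ (λ σ z → σ ∙ W z t) sum≡ end ⟩
          g ∙ (g ⁻¹ ∙ W s t ⁻¹) ∙ W s t             ≡⟨ cong (_∙ W s t) (\\-leftDividesˡ g (W s t ⁻¹)) ⟩
          W s t ⁻¹ ∙ W s t                          ≡⟨ inverseˡ (W s t) ⟩
          ε                                         ∎)

    -- Each of `h` rounds uses up three spare vertices and preserves the budget
    -- `q ≤ h * 2 + length L`, which `close` refutes at zero. The condition on `t ≡ s` admits the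
    -- initial state; later starts differ from `s`.
    exhaust : Generates → 2-TorsionFree → NoZeroCycle W → 2 ≤ q → ∀ h {R t g L} →
      length R ≡ h * 3 → Unique R → s ∉ R → Unique L → 1 ≤ length L → (t ≡ s → length L ≤ 1) →
      All (λ σ → Reach R t (g ∙ σ)) L → ¬ q ≤ h * 2 + length L
    exhaust _ _ noZero 2≤q zero _ _ _ uniqueL _ t≡s⇒L≤1 reach =
      ℕ.<⇒≱ (close noZero 2≤q uniqueL t≡s⇒L≤1 reach)
    exhaust generates 2-torsion-free noZero 2≤q (suc h) {a ∷ b ∷ c ∷ R} {L = L}
      len unique@(_ ∷ _ ∷ _ ∷ uniqueR) s∉ uniqueL 1≤L _ reach q≤
      with t′ , g′ , L′ , t′≢s , uniqueL′ , reach′ , bound ←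
        next-end generates 2-torsion-free noZero unique s∉ uniqueL 1≤L reach
      = exhaust generates 2-torsion-free noZero 2≤q h
          (ℕ.+-cancelˡ-≡ 3 _ _ len) uniqueR (s∉ ∘ there ∘ there ∘ there) uniqueL′
          (ℕ.≤-trans (ℕ.⊓-glb (ℕ.<⇒≤ 2≤q) (s≤s z≤n)) bound)
          (λ t′≡s → contradiction t′≡s t′≢s) reach′ (enough-steps h q≤ bound)

  noLabelling : Generates → 2-TorsionFree → 2 ≤ q → ∀ h → q ≤ h * 2 + 1 →
                ¬ HasZeroSumFreeLabelling G (suc (h * 3))
  noLabelling generates 2-torsion-free 2≤q h q≤ (w , free) =
    exhaust (toMatrix w) zero generates 2-torsion-free (zeroSumFree⇒noZeroCycle free) 2≤q h
      -- Initially both ends are `zero`, the only path is empty, and the other `h * 3` vertices are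
      -- spare.
      {R = tabulate suc} {t = zero} {g = ε} {L = ε ∷ []}
      (length-tabulate suc) (Unique.tabulate⁺ Fin.suc-injective) 0∉ ([] ∷ []) ℕ.≤-refl (λ _ → ℕ.≤-refl)
      (([] , refl , ([] ∷ []) , (0∉ ∷ []) , sym (identityˡ ε)) ∷ []) q≤
    where
      0∉ : zero ∉ tabulate {n = h * 3} suc
      0∉ = All¬⇒¬Any (All.tabulate⁺ λ _ ())

-- Arithmetic of the cyclic group of prime order

module _ (p : ℕ) .{{_ : NonZero p}} (p-prime : Prime p) where
  open AbelianGroup (ℤ/ p) using (_∙_; ε; isAbelianGroup)
  open FiniteGroup isAbelianGroup using (Generates; 2-TorsionFree)
  open RawMonoidDefinitions (AbelianGroup.rawMonoid (ℤ/ p)) using () renaming (_×_ to _·_)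
  open ≡-Reasoning

  toℕ-· : ∀ m x → toℕ (m · x) ≡ (m * toℕ x) % p
  toℕ-· zero    x = toℕ-mod 0 p
  toℕ-· (suc m) x = begin
    toℕ (x ∙ (m · x))                     ≡⟨ toℕ-mod (toℕ x + toℕ (m · x)) p ⟩
    (toℕ x + toℕ (m · x)) % p             ≡⟨ cong (λ r → (toℕ x + r) % p) (toℕ-· m x) ⟩
    (toℕ x + (m * toℕ x) % p) % p         ≡⟨ %-distribˡ-+ (toℕ x) _ p ⟩
    (toℕ x % p + (m * toℕ x) % p % p) % p
      ≡⟨ cong (λ r → (toℕ x % p + r) % p) (m%n%n≡m%n (m * toℕ x) p) ⟩
    (toℕ x % p + (m * toℕ x) % p) % p     ≡⟨ %-distribˡ-+ (toℕ x) _ p ⟨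
    (toℕ x + m * toℕ x) % p               ∎

  toℕ-ε : toℕ ε ≡ 0
  toℕ-ε = trans (toℕ-mod 0 p) (m*n%n≡0 0 p)

  ε≡ : ∀ {x : Fin p} → toℕ x ≡ 0 → x ≡ ε
  ε≡ x≡0 = toℕ-injective (trans x≡0 (sym toℕ-ε))

  -- Coprimality gives a multiple of `x` congruent to 1 or - 1 modulo `p`, which is then scaled to
  -- reach `y`.
  ℤ/-generates : Generates
  ℤ/-generates {x} x≢ε y = from-Bézout
      (coprime-Bézout (prime⇒coprime p-prime {{≢-nonZero (x≢ε ∘ ε≡)}} (toℕ<n x)))
    where
      a = toℕ x
      b = toℕ y

      multiple : ∀ m k l → m * a + k * p ≡ b + l * p → ∃[ m ] m · x ≡ y
      multiple m k l eq = m , toℕ-injective (begin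
        toℕ (m · x)          ≡⟨ toℕ-· m x ⟩
        (m * a) % p          ≡⟨ [m+kn]%n≡m%n (m * a) k p ⟨
        (m * a + k * p) % p  ≡⟨ cong (_% p) eq ⟩
        (b + l * p) % p      ≡⟨ [m+kn]%n≡m%n b l p ⟩
        b % p                ≡⟨ m<n⇒m%n≡m (toℕ<n y) ⟩
        b                    ∎)

      from-Bézout : Bézout.Identity 1 p a → ∃[ m ] m · x ≡ y
      from-Bézout (Bézout.-+ u v 1+up≡va) = multiple (b * v) 0 (b * u) (begin
        b * v * a + 0      ≡⟨ lemma₁ b v a ⟩
        b * (v * a)        ≡⟨ cong (b *_) 1+up≡va ⟨
        b * (1 + u * p)    ≡⟨ lemma₂ b u p ⟩
        b + b * u * p      ∎)
        where
          lemma₁ : ∀ b v a → b * v * a + 0 ≡ b * (v * a)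
          lemma₁ = solve-∀
          lemma₂ : ∀ b u p → b * (1 + u * p) ≡ b + b * u * p
          lemma₂ = solve-∀
      -- Here `v * a` is - 1 modulo `p`, so the scaling factor is `p ∸ b`, a representative of - b.
      from-Bézout (Bézout.+- u v 1+va≡up) = multiple (c * v) 1 (c * u) (begin
        c * v * a + 1 * p        ≡⟨ cong (λ r → c * v * a + 1 * r) c+b≡p ⟨
        c * v * a + 1 * (c + b)  ≡⟨ lemma₁ c v a b ⟩
        b + c * (1 + v * a)      ≡⟨ cong (λ r → b + c * r) 1+va≡up ⟩
        b + c * (u * p)          ≡⟨ cong (b +_) (ℕ.*-assoc c u p) ⟨
        b + c * u * p            ∎)
        where
          c = p ∸ b
          c+b≡p = ℕ.m∸n+n≡m (toℕ≤n y)
          lemma₁ : ∀ c v a b → c * v * a + 1 * (c + b) ≡ b + c * (1 + v * a)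
          lemma₁ = solve-∀

  -- By Euclid's lemma `p` divides 2 or `x`, and 2 is too small.
  ℤ/-2-torsion-free : 3 ≤ p → 2-TorsionFree
  ℤ/-2-torsion-free 3≤p {x} x+x≡ε = case euclidsLemma 2 (toℕ x) p-prime p∣2x of λ where
      (inj₁ p∣2) → contradiction (∣⇒≤ p∣2) (ℕ.<⇒≱ 3≤p)
      (inj₂ p∣x) → ε≡ (trans (sym (m<n⇒m%n≡m (toℕ<n x))) (n∣m⇒m%n≡0 _ p p∣x))
    where
      p∣2x : p ∣ 2 * toℕ x
      p∣2x = m%n≡0⇒n∣m _ p (begin
        (2 * toℕ x) % p        ≡⟨ cong (λ r → (toℕ x + r) % p) (ℕ.+-identityʳ (toℕ x)) ⟩
        (toℕ x + toℕ x) % p    ≡⟨ toℕ-mod _ p ⟨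
        toℕ (x ∙ x)            ≡⟨ cong toℕ x+x≡ε ⟩
        toℕ ε                  ≡⟨ toℕ-ε ⟩
        0                      ∎)

  odd-prime : 3 ≤ p → p ≡ 1 + p / 2 * 2
  odd-prime 3≤p = trans (m≡m%n+[m/n]*n p 2) (cong (_+ p / 2 * 2) p%2≡1)
    where
      p%2≡1 : p % 2 ≡ 1
      p%2≡1 with p % 2 in eq | m%n<n p 2
      ... | 1           | _ = refl
      ... | suc (suc _) | s≤s (s≤s ())
      ... | 0           | _ with prime⇒irreducible p-prime (m%n≡0⇒n∣m p 2 eq)
      ...   | inj₂ refl = contradiction 3≤p λ where (s≤s (s≤s ()))

theorem2 : ∀ (p : ℕ) .{{_ : NonZero p}} → Prime p → 3 ≤ p →
    ∃[ m ] (Is-n (ℤ/ p) m × m ≤ (3 * p ∸ 1) / 2)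
theorem2 p p-prime 3≤p = subst (λ N → ∃[ m ] (Is-n (ℤ/ p) m × m ≤ N)) (sym bound)
  (¬labelling⇒Is-n (s≤s (ℕ.*-mono-≤ {1} {h} {1} {3} (/-monoˡ-≤ 2 (ℕ.<⇒≤ 3≤p)) (s≤s z≤n)))
    (noLabelling (ℤ/-generates p p-prime) (ℤ/-2-torsion-free p p-prime 3≤p) (ℕ.<⇒≤ 3≤p) h
      (ℕ.≤-reflexive (trans p≡ (ℕ.+-comm 1 (h * 2))))))
  where
    open AbelianGroup (ℤ/ p) using (isAbelianGroup)
    open FiniteGroup isAbelianGroup using (¬labelling⇒Is-n; noLabelling)
    -- With p = 1 + 2h the bound is 1 + 3h: one base vertex and `h` spare triples.
    h = p / 2
    p≡ = odd-prime p p-prime 3≤p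
    bound : (3 * p ∸ 1) / 2 ≡ suc (h * 3)
    bound = begin
      (3 * p ∸ 1) / 2              ≡⟨ cong (λ r → (3 * r ∸ 1) / 2) p≡ ⟩
      (3 * (1 + h * 2) ∸ 1) / 2    ≡⟨ cong (λ r → (r ∸ 1) / 2) (rearrange h) ⟩
      (suc (h * 3) * 2) / 2        ≡⟨ m*n/n≡m (suc (h * 3)) 2 ⟩
      suc (h * 3)                  ∎
      where
        open ≡-Reasoning
        rearrange : ∀ h → 3 * (1 + h * 2) ≡ 1 + suc (h * 3) * 2
        rearrange = solve-∀
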